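{- Let $1 \le m \le n$ be integers. The constraint graph of $\mathcal{C}^\pm_{n,\le m}$ (that is, the constraint graph of $\mathcal{C}^+_{n,\le m}$ and likewise that of $\mathcal{C}^-_{n,\le m}$) has maximum degree $3$ and pathwidth $2$.
   Context: **VCSP-instances.** A binary Boolean VCSP-instance $\mathcal{C}$ on a finite set $V$ of variable indexes is a set of constraints, each given by a nonzero integer weight $c_T$ with a scope $T \subseteq V$, $|T| \le 2$ (unary if $|T|=1$, binary if $|T|=2$); we write $c_i$ for $c_{\{i\}}$, and absent scopes have weight $0$. The constraint graph of $\mathcal{C}$ has vertex set $V$ and an edge $\{i,j\}$ ($i\neq j$) exactly when there is a binary constraint with scope $\{i,j\}$. Pathwidth and maximum degree are the usual graph parameters of the constraint graph. **The construction.** Fix an integer $n \ge 1$ and put $S = 2n+1$, $M_k = 6(2^k-2)$, $s_k = n+1-k$ for $1 \le k \le n$. Let $V_k = \{(k,i) : 1 \le i \le 6\}$. For $1\le k\le n$, the gadgets $\mathcal{C}^-_{n,k}$ and $\mathcal{C}^+_{n,k}$ are the VCSP-instances on $V_k$ with the following constraints. Unary weights: $c_{(k,1)} = -(2(M_k+5)+1)S$ in $\mathcal{C}^-_{n,k}$, and $c_{(k,1)} = S$ in $\mathcal{C}^+_{n,k}$; in both gadgets $c_{(k,2)} = -(M_k+4)S - s_k$, $c_{(k,3)} = -(M_k+3)S$, $c_{(k,4)} = -(M_k+5)S$, $c_{(k,5)} = -S$, $c_{(k,6)} = -(M_k+1)S$. Binary weights (in both gadgets): $c_{\{(k,1),(k,2)\}}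 = (M_k+5)S$, $c_{\{(k,1),(k,4)\}} = (M_k+5)S + s_k$, $c_{\{(k,2),(k,3)\}} = (M_k+4)S$, $c_{\{(k,4),(k,5)\}} = (M_k+4)S$, $c_{\{(k,3),(k,6)\}} = (M_k+2)S$, $c_{\{(k,5),(k,6)\}} = -(M_k+2)S$. For $1 \le m \le n$ and a sign $\pm$, $\mathcal{C}^\pm_{n,\le m}$ is the VCSP-instance on the $6m$ variables $V_1\cup\dots\cup V_m$ consisting of all constraints of $\mathcal{C}^\pm_{n,m}$, all constraints of $\mathcal{C}^-_{n,k}$ for $1 \le k \le m-1$, and, for every $2 \le k \le m$, one additional binary constraint with scope $\{(k,6),(k-1,1)\}$ and weight $c_{\{(k,6),(k-1,1)\}} = M_k S$. There are no other constraints.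
   Formalization: For m = 1 the constraint graph is a single 6-cycle of maximum degree 2, so maximum degree exactly 3 is claimed only for m ≥ 2, and at most 3 for m = 1; pathwidth 2 is claimed for all 1 ≤ m ≤ n. -}

module Defs where

open import Data.Bool.Base using (if_then_else_)
import Data.Bool.Properties as Bool
open import Data.Empty using (⊥-elim)
open import Data.Fin.Base as Fin using (Fin; zero; suc; toℕ; fromℕ; inject₁; combine)
open import Data.Fin.Patterns using (0F; 1F; 2F; 3F; 4F; 5F)
import Data.Fin.Properties as Fin
open import Data.Fin.Subset using (Subset; inside; outside; _∈_; _∪_; ⁅_⁆; ∣_∣)
open import Data.Fin.Subset.Properties using (∪-comm; ∣⁅x⁆∣≡1)
open import Data.Integer.Base using (ℤ; +_; -_; 0ℤ)
import Data.Integer.Properties as ℤ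
open import Data.List.Base using (List; []; _∷_; _++_; map; concatMap; allFin; tabulate)
open import Data.List.Extrema.Nat using (max)
open import Data.Nat.Base using (ℕ; zero; suc; pred; _+_; _*_; _∸_; _^_; _≤_; z≤n; s≤s)
import Data.Nat.Properties as ℕ
open import Data.Product.Base using (_×_; _,_; ∃-syntax; Σ-syntax)
open import Data.Sign.Base using (Sign)
open import Data.Vec.Base as Vec using ([]; _∷_)
import Data.Vec.Properties as Vec
open import Data.Vec.Functional using (Vector)
open import Relation.Binary.Definitions using (Symmetric; Irreflexive; Decidable)
open import Relation.Binary.PropositionalEquality
  using (_≡_; _≢_; refl; sym; trans; cong; subst; ≢-sym)
open import Relation.Nullary.Decidable using (does; yes; no; ¬?; _×-dec_)

private
  variable
    N : ℕ

------------------------------------------------------------------------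
-- Finite simple graphs

record Graph (N : ℕ) : Set₁ where
  field
    _~_    : Fin N → Fin N → Set
    _~?_   : Decidable _~_
    symm   : Symmetric _~_
    irrefl : Irreflexive _≡_ _~_

  neighbours : Fin N → Subset N
  neighbours v = Vec.tabulate (λ u → does (v ~? u))

  degree : Fin N → ℕ
  degree v = ∣ neighbours v ∣

maxDegree : Graph N → ℕ
maxDegree G = max 0 (map (Graph.degree G) (allFin _))

record PathDecomposition (G : Graph N) : Set where
  open Graph G
  field
    {length}      : ℕ
    bag           : Vector (Subset N) length
    covers-vertex : ∀ v → ∃[ t ] v ∈ bag t
    covers-edge   : ∀ {u v} → u ~ v → ∃[ t ] (u ∈ bag t × v ∈ bag t)
    contiguous    : ∀ {v r s t} → r Fin.≤ s → s Fin.≤ t →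
                    v ∈ bag r → v ∈ bag t → v ∈ bag s

  -- On the graph without vertices the width should be -1 but is 0 here.
  width : ℕ
  width = pred (max 0 (tabulate (λ t → ∣ bag t ∣)))

open PathDecomposition using (width)

HasPathwidth : Graph N → ℕ → Set
HasPathwidth G w =
  (Σ[ D ∈ PathDecomposition G ] width D ≡ w) ×
  (∀ (D : PathDecomposition G) → w ≤ width D)

------------------------------------------------------------------------
-- Binary Boolean VCSP-instances

-- The constraints of an instance are the scopes of nonzero weight.
record VCSP (N : ℕ) : Set where
  field
    weight : Subset N → ℤ
    arity  : ∀ T → weight T ≢ 0ℤ → ∣ T ∣ ≤ 2

constraintGraph : VCSP N → Graph N
constraintGraph C = record
  { _~_    = λ i j → i ≢ j × weight (⁅ i ⁆ ∪ ⁅ j ⁆) ≢ 0ℤ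
  ; _~?_   = λ i j → ¬? (i Fin.≟ j) ×-dec ¬? (weight (⁅ i ⁆ ∪ ⁅ j ⁆) ℤ.≟ 0ℤ)
  ; symm   = λ {i} {j} (i≢j , w≢0) →
               ≢-sym i≢j , subst (λ T → weight T ≢ 0ℤ) (∪-comm ⁅ i ⁆ ⁅ j ⁆) w≢0
  ; irrefl = λ i≡j (i≢j , _) → i≢j i≡j
  }
  where open VCSP C

record Constraint (N : ℕ) : Set where
  field
    scope   : Subset N
    ∣scope∣ : ∣ scope ∣ ≤ 2
    value   : ℤ

open Constraint

unary : Fin N → ℤ → Constraint N
unary i c = record
  { scope = ⁅ i ⁆ ; ∣scope∣ = subst (_≤ 2) (sym (∣⁅x⁆∣≡1 i)) (s≤s z≤n) ; value = c }

∣p∪q∣≤∣p∣+∣q∣ : (p q : Subset N) → ∣ p ∪ q ∣ ≤ ∣ p ∣ + ∣ q ∣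
∣p∪q∣≤∣p∣+∣q∣ []            []            = z≤n
∣p∪q∣≤∣p∣+∣q∣ (outside ∷ p) (outside ∷ q) = ∣p∪q∣≤∣p∣+∣q∣ p q
∣p∪q∣≤∣p∣+∣q∣ (outside ∷ p) (inside  ∷ q) =
  subst (suc ∣ p ∪ q ∣ ≤_) (sym (ℕ.+-suc ∣ p ∣ ∣ q ∣)) (s≤s (∣p∪q∣≤∣p∣+∣q∣ p q))
∣p∪q∣≤∣p∣+∣q∣ (inside  ∷ p) (outside ∷ q) = s≤s (∣p∪q∣≤∣p∣+∣q∣ p q)
∣p∪q∣≤∣p∣+∣q∣ (inside  ∷ p) (inside  ∷ q) =
  s≤s (ℕ.≤-trans (∣p∪q∣≤∣p∣+∣q∣ p q) (ℕ.+-monoʳ-≤ ∣ p ∣ (ℕ.n≤1+n ∣ q ∣)))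

binary : Fin N → Fin N → ℤ → Constraint N
binary i j c = record
  { scope   = ⁅ i ⁆ ∪ ⁅ j ⁆
  ; ∣scope∣ = subst (∣ ⁅ i ⁆ ∪ ⁅ j ⁆ ∣ ≤_)
                (trans (cong (_+ ∣ ⁅ j ⁆ ∣) (∣⁅x⁆∣≡1 i)) (cong suc (∣⁅x⁆∣≡1 j)))
                (∣p∪q∣≤∣p∣+∣q∣ ⁅ i ⁆ ⁅ j ⁆)
  ; value   = c
  }

-- If a scope were listed twice, the first entry would count; the lists
-- below have pairwise distinct scopes.
listWeight : List (Constraint N) → Subset N → ℤ
listWeight []       T = 0ℤ
listWeight (c ∷ cs) T =
  if does (Vec.≡-dec Bool._≟_ (scope c) T) then value c else listWeight cs T

listWeight-arity : (cs : List (Constraint N)) → ∀ T → listWeight cs T ≢ 0ℤ → ∣ T ∣ ≤ 2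
listWeight-arity []       T w≢0 = ⊥-elim (w≢0 refl)
listWeight-arity (c ∷ cs) T w≢0 with Vec.≡-dec Bool._≟_ (scope c) T
... | yes refl = ∣scope∣ c
... | no  _    = listWeight-arity cs T w≢0

fromConstraints : List (Constraint N) → VCSP N
fromConstraints cs = record { weight = listWeight cs ; arity = listWeight-arity cs }

------------------------------------------------------------------------
-- The construction

-- Both truncated subtractions are exact for 1 ≤ k ≤ n.

M : ℕ → ℕ
M k = 6 * (2 ^ k ∸ 2)

S : ℕ → ℕ
S n = 2 * n + 1

s : ℕ → ℕ → ℕ
s n k = (n + 1) ∸ k

-- The constraints of the gadget with parameters n and k, where v 0F, …, v 5F
-- are the variables (k,1), …, (k,6).
gadget : Sign → (n k : ℕ) → (Fin 6 → Fin N) → List (Constraint N)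
gadget σ n k v =
    unary (v 0F) (c₁ σ)
  ∷ unary (v 1F) (- + ((M k + 4) * S n + s n k))
  ∷ unary (v 2F) (- + ((M k + 3) * S n))
  ∷ unary (v 3F) (- + ((M k + 5) * S n))
  ∷ unary (v 4F) (- + S n)
  ∷ unary (v 5F) (- + ((M k + 1) * S n))
  ∷ binary (v 0F) (v 1F) (+ ((M k + 5) * S n))
  ∷ binary (v 0F) (v 3F) (+ ((M k + 5) * S n + s n k))
  ∷ binary (v 1F) (v 2F) (+ ((M k + 4) * S n))
  ∷ binary (v 3F) (v 4F) (+ ((M k + 4) * S n))
  ∷ binary (v 2F) (v 5F) (+ ((M k + 2) * S n))
  ∷ binary (v 4F) (v 5F) (- + ((M k + 2) * S n))
  ∷ []
  where
  c₁ : Sign → ℤ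
  c₁ Sign.- = - + ((2 * (M k + 5) + 1) * S n)
  c₁ Sign.+ = + S n

-- The variable (k,i) is  combine k′ i′  where k = 1 + toℕ k′ and i = 1 + toℕ i′.
constraints≤ : Sign → (n m : ℕ) → List (Constraint (m * 6))
constraints≤ σ n zero    = []
constraints≤ σ n (suc m) =
     gadget σ n (suc m) (combine (fromℕ m))
  ++ concatMap (λ k → gadget Sign.- n (suc (toℕ k)) (combine (inject₁ k))) (allFin m)
  ++ map (λ k → binary (combine (suc k) 5F) (combine (inject₁ k) 0F)
                       (+ (M (2 + toℕ k) * S n)))
         (allFin m)

C≤ : Sign → (n m : ℕ) → VCSP (m * 6)
C≤ σ n m = fromConstraints (constraints≤ σ n m)

{-# OPTIONS --safe #-}
module Submission where

-- All listed constraints have nonzero value, so two distinct variables are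
-- adjacent exactly when their pair is a listed scope (listWeight≢0⁺,
-- listWeight≢0⁻). The constraint graph is thus a chain of m hexagons: the
-- cycle (k,1) (k,2) (k,3) (k,6) (k,5) (k,4) for each k, and an edge between
-- (k+1,6) and (k,1) for each k < m.
--
-- Degrees. A neighbour of a vertex is its successor on the cycle, its
-- predecessor on the cycle, or its partner on a linking edge, and each of the
-- three is unique. Hence all degrees are at most 3, and (1,1) attains 3 as
-- soon as there is a second gadget.
--
-- Pathwidth at most 2. Sweep each hexagon from its vertex 6 to its vertex 1
-- in five time slots, following both arcs, so that every vertex is alive
-- during an interval of slots and the endpoints of every edge are alive
-- together. The vertices can be given three colours such that vertices of the
-- same colour are never alive together; so no bag has more than three.
--
-- Pathwidth at least 2. Among the vertices of a hexagon choose one, v, whose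
-- last bag comes earliest. Each of its two neighbours on the cycle shares a
-- bag with v, no later than the last bag of v, and has its own last bag no
-- earlier; by contiguity it lies in the last bag of v. That bag has three
-- elements (minDegree2⇒2≤width).

open import Defs
import Data.Bool.Properties as Bool
open import Data.Fin.Base as Fin
  using (Fin; zero; suc; toℕ; fromℕ; inject₁; combine; remQuot; punchOut)
open import Data.Fin.Patterns using (0F; 1F; 2F; 3F; 4F; 5F)
import Data.Fin.Properties as Fin
open import Data.Fin.Relation.Unary.Top using (view; ‵fromℕ; ‵inj₁)
open import Data.Fin.Subset using (Subset; inside; outside; _∈_; _∪_; ⁅_⁆; ∣_∣)
open import Data.Fin.Subset.Properties
  using (_∈?_; ∪-comm; x∈⁅x⁆; x∈⁅y⁆⇒x≡y; x∈p∪q⁻; x∈p∪q⁺; x∈p∧x≢y⇒x∈p-y; x∈p⇒∣p-x∣<∣p∣)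
open import Data.Integer.Base as ℤ using (+_; 0ℤ)
open import Data.List.Base using (List; []; _∷_; allFin; filter; lookup)
open import Data.List.Extrema.Nat
  using (argmin; argmax; f[argmin]≤f[xs]; f[xs]≤f[argmax]; argmax-all; max≤v⁺; xs≤max)
open import Data.List.Membership.Propositional.Properties
  using (∈-map⁺; ∈-tabulate⁺; ∈-allFin; ∈-filter⁺)
open import Data.List.Relation.Unary.All as All using (All; []; _∷_)
import Data.List.Relation.Unary.All.Properties as All
open import Data.List.Relation.Unary.Any as Any using (Any; here; there)
import Data.List.Relation.Unary.Any.Properties as Any
open import Data.Nat.Base using (ℕ; zero; suc; _+_; _*_; _≤_; _<_; z≤n; s≤s; z<s)
import Data.Nat.Properties as ℕ
open import Data.Product.Base using (_×_; _,_; proj₁; proj₂; ∃-syntax; Σ-syntax; uncurry)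
open import Data.Sign.Base using (Sign)
open import Data.Sum.Base using (_⊎_; inj₁; inj₂)
import Data.Vec.Base as Vec
import Data.Vec.Properties as Vec
open import Function.Base using (_∘_)
open import Relation.Binary.Construct.Closure.Symmetric as SymClosure using (SymClosure; fwd; bwd)
open import Relation.Binary.Definitions using (tri<; tri≈; tri>)
open import Relation.Binary.PropositionalEquality
  using (_≡_; _≢_; refl; sym; trans; cong; subst; subst₂; ≢-sym)
open import Relation.Nullary.Decidable
  using (does; yes; no; _×-dec_; _→-dec_; ¬?; from-yes; dec-true)
open import Relation.Nullary.Negation using (contradiction)
open import Relation.Unary using (Decidable)

private
  variable
    N c : ℕ

-- Cardinalities of finite subsets

∈-tabulate-does⁺ : {P : Fin N → Set} (P? : Decidable P) {x : Fin N} →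
                   P x → x ∈ Vec.tabulate (does ∘ P?)
∈-tabulate-does⁺ P? {x} px = Vec.lookup⇒[]= x _
  (trans (Vec.lookup∘tabulate (does ∘ P?) x) (dec-true (P? x) px))

∈-tabulate-does⁻ : {P : Fin N → Set} (P? : Decidable P) {x : Fin N} →
                   x ∈ Vec.tabulate (does ∘ P?) → P x
∈-tabulate-does⁻ P? {x} x∈
  with P? x | trans (sym (Vec.lookup∘tabulate (does ∘ P?) x)) (Vec.[]=⇒lookup x∈)
... | yes px | _  = px
... | no  _  | ()

-- A subset that embeds into Fin c has at most c elements. The embedding may
-- use the membership proof, so it need not extend to all of Fin N.
injection⇒∣p∣≤ : (p : Subset N) (f : ∀ {x} → x ∈ p → Fin c) →
                 (∀ {x y} (x∈p : x ∈ p) (y∈p : y ∈ p) → f x∈p ≡ f y∈p → x ≡ y) →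
                 ∣ p ∣ ≤ c
injection⇒∣p∣≤ Vec.[] f inj = z≤n
injection⇒∣p∣≤ (outside Vec.∷ p) f inj =
  injection⇒∣p∣≤ p (f ∘ Vec.there)
    λ x∈p y∈p → Fin.suc-injective ∘ inj (Vec.there x∈p) (Vec.there y∈p)
injection⇒∣p∣≤ {c = zero} (inside Vec.∷ p) f inj with () ← f Vec.here
injection⇒∣p∣≤ {c = suc c} (inside Vec.∷ p) f inj =
  s≤s (injection⇒∣p∣≤ p (λ x∈p → punchOut (f₀≢f x∈p))
    λ x∈p y∈p eq → Fin.suc-injective (inj (Vec.there x∈p) (Vec.there y∈p)
      (Fin.punchOut-injective (f₀≢f x∈p) (f₀≢f y∈p) eq)))
  where
  f₀≢f : ∀ {x} (x∈p : x ∈ p) → f Vec.here ≢ f (Vec.there x∈p)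
  f₀≢f x∈p eq with () ← inj Vec.here (Vec.there x∈p) eq

3≤∣p∣ : {p : Subset N} {x y z : Fin N} → x ∈ p → y ∈ p → z ∈ p →
        x ≢ y → x ≢ z → y ≢ z → 3 ≤ ∣ p ∣
3≤∣p∣ x∈p y∈p z∈p x≢y x≢z y≢z =
  ℕ.≤-<-trans (ℕ.≤-<-trans (ℕ.≤-<-trans z≤n
    (x∈p⇒∣p-x∣<∣p∣ z∈p-x-y)) (x∈p⇒∣p-x∣<∣p∣ y∈p-x)) (x∈p⇒∣p-x∣<∣p∣ x∈p)
  where
  y∈p-x   = x∈p∧x≢y⇒x∈p-y y∈p (≢-sym x≢y)
  z∈p-x-y = x∈p∧x≢y⇒x∈p-y (x∈p∧x≢y⇒x∈p-y z∈p (≢-sym x≢z)) (≢-sym y≢z)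

⁅⁆∪⁅⁆-injective : {a b u v : Fin N} → u ≢ v → ⁅ a ⁆ ∪ ⁅ b ⁆ ≡ ⁅ u ⁆ ∪ ⁅ v ⁆ →
                  (u ≡ a × v ≡ b) ⊎ (u ≡ b × v ≡ a)
⁅⁆∪⁅⁆-injective {a = a} {b} {u} {v} u≢v eq
  with member (x∈p∪q⁺ (inj₁ (x∈⁅x⁆ u))) | member (x∈p∪q⁺ (inj₂ (x∈⁅x⁆ v)))
  where
  member : ∀ {x} → x ∈ ⁅ u ⁆ ∪ ⁅ v ⁆ → x ≡ a ⊎ x ≡ b
  member x∈ with x∈p∪q⁻ ⁅ a ⁆ ⁅ b ⁆ (subst (_ ∈_) (sym eq) x∈)
  ... | inj₁ x∈a = inj₁ (x∈⁅y⁆⇒x≡y a x∈a)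
  ... | inj₂ x∈b = inj₂ (x∈⁅y⁆⇒x≡y b x∈b)
... | inj₁ refl | inj₁ refl = contradiction refl u≢v
... | inj₁ u≡a  | inj₂ v≡b  = inj₁ (u≡a , v≡b)
... | inj₂ u≡b  | inj₁ v≡a  = inj₂ (u≡b , v≡a)
... | inj₂ refl | inj₂ refl = contradiction refl u≢v

⁅⁆≢⁅⁆∪⁅⁆ : {a u v : Fin N} → u ≢ v → ⁅ a ⁆ ≢ ⁅ u ⁆ ∪ ⁅ v ⁆
⁅⁆≢⁅⁆∪⁅⁆ {a = a} {u} {v} u≢v eq = u≢v (trans
  (x∈⁅y⁆⇒x≡y a (subst (u ∈_) (sym eq) (x∈p∪q⁺ (inj₁ (x∈⁅x⁆ u)))))
  (sym (x∈⁅y⁆⇒x≡y a (subst (v ∈_) (sym eq) (x∈p∪q⁺ (inj₂ (x∈⁅x⁆ v)))))))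

-- Maximum degree

module _ (G : Graph N) where
  open Graph G

  maxDegree≤ : ∀ {d} → (∀ v → degree v ≤ d) → maxDegree G ≤ d
  maxDegree≤ deg≤ = max≤v⁺ z≤n (All.map⁺ (All.tabulate⁺ deg≤))

  degree≤maxDegree : ∀ v → degree v ≤ maxDegree G
  degree≤maxDegree v = All.lookup (xs≤max 0 _) (∈-map⁺ degree (∈-allFin v))

-- Path decompositions

attainsMinimum : ∀ {n} (f : Fin (suc n) → ℕ) → ∃[ i ] ∀ j → f i ≤ f j
attainsMinimum f = argmin f zero (allFin _) ,
  λ j → All.lookup (f[argmin]≤f[xs] {f = f} zero (allFin _)) (∈-allFin j)

module _ {G : Graph N} (D : PathDecomposition G) where
  open Graph G
  open PathDecomposition D

  ≤width : ∀ {w} t → w < ∣ bag t ∣ → w ≤ width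
  ≤width t w<∣bag∣ =
    ℕ.<⇒≤pred (ℕ.<-≤-trans w<∣bag∣ (All.lookup (xs≤max 0 _) (∈-tabulate⁺ t)))

  width≤ : ∀ {w} → (∀ t → ∣ bag t ∣ ≤ suc w) → width ≤ w
  width≤ bag≤ = ℕ.pred-mono-≤ (max≤v⁺ z≤n (All.tabulate⁺ bag≤))

  -- The last bag that contains v.
  lastBag : ∀ v → ∃[ r ] (v ∈ bag r × (∀ {t} → v ∈ bag t → t Fin.≤ r))
  lastBag v with t₀ , v∈t₀ ← covers-vertex v =
    argmax toℕ t₀ ts ,
    argmax-all toℕ {P = λ t → v ∈ bag t} v∈t₀ (All.all-filter v∈bag? (allFin length)) ,
    λ {t} v∈t → All.lookup (f[xs]≤f[argmax] t₀ ts) (∈-filter⁺ v∈bag? (∈-allFin t) v∈t)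
    where
    v∈bag? : Decidable (λ t → v ∈ bag t)
    v∈bag? t = v ∈? bag t
    ts = filter v∈bag? (allFin length)

  -- The vertices x i induce a subgraph in which each x i has the two distinct
  -- neighbours x (p i) and x (s i).
  minDegree2⇒2≤width : ∀ {n} (x : Fin (suc n) → Fin N) (p s : Fin (suc n) → Fin (suc n)) →
                       (∀ i → x i ~ x (p i)) → (∀ i → x i ~ x (s i)) →
                       (∀ i → x (p i) ≢ x (s i)) → 2 ≤ width
  minDegree2⇒2≤width x p s x~xp x~xs xp≢xs =
    go (proj₁ ∘ lastBag) (proj₁ ∘ proj₂ ∘ lastBag) (λ v → proj₂ (proj₂ (lastBag v)))
       (attainsMinimum (λ i → toℕ (proj₁ (lastBag (x i)))))
    where
    -- end v is the index of the last bag that contains v.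
    go : (end : Fin N → Fin length) → (∀ v → v ∈ bag (end v)) →
         (∀ v {t} → v ∈ bag t → t Fin.≤ end v) →
         ∃[ i ] (∀ j → end (x i) Fin.≤ end (x j)) → 2 ≤ width
    -- x i is a vertex whose last bag comes earliest.
    go end ∈end ≤end (i , endᵢ≤end) =
      ≤width (end (x i))
        (3≤∣p∣ (∈end (x i)) (neighbour∈ (x~xp i)) (neighbour∈ (x~xs i))
          (λ eq → irrefl eq (x~xp i)) (λ eq → irrefl eq (x~xs i)) (xp≢xs i))
      where
      neighbour∈ : ∀ {j} → x i ~ x j → x j ∈ bag (end (x i))
      neighbour∈ {j} xᵢ~xⱼ with r , xᵢ∈r , xⱼ∈r ← covers-edge xᵢ~xⱼ =
        contiguous (≤end (x i) xᵢ∈r) (endᵢ≤end j) xⱼ∈r (∈end (x j))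

hasPathwidth : ∀ {G : Graph N} {w} (D : PathDecomposition G) → PathDecomposition.width D ≤ w →
               (∀ D → w ≤ PathDecomposition.width D) → HasPathwidth G w
hasPathwidth D width≤w w≤width = (D , ℕ.≤-antisym width≤w (w≤width D)) , w≤width

-- Each vertex v lives during the interval of times from lo v to hi v. As
-- adjacency is symmetric, lo≤hi-adj says that the intervals of adjacent
-- vertices meet.
module _ (G : Graph N) {l : ℕ} (lo : Fin N → Fin l) (hi : Fin N → ℕ)
         (lo≤hi : ∀ v → toℕ (lo v) ≤ hi v)
         (lo≤hi-adj : ∀ {u v} → Graph._~_ G u v → toℕ (lo u) ≤ hi v)
         where
  open Graph G

  alive? : (t : Fin l) → Decidable (λ v → toℕ (lo v) ≤ toℕ t × toℕ t ≤ hi v)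
  alive? t v = toℕ (lo v) ℕ.≤? toℕ t ×-dec toℕ t ℕ.≤? hi v

  -- The bag at time t consists of the vertices alive at t.
  intervalDecomposition : PathDecomposition G
  intervalDecomposition = record
    { bag           = λ t → Vec.tabulate (does ∘ alive? t)
    ; covers-vertex = λ v → lo v , ∈-tabulate-does⁺ (alive? (lo v)) (ℕ.≤-refl , lo≤hi v)
    ; covers-edge   = covers-edge
    ; contiguous    = λ {_} {r} {s} {t} r≤s s≤t v∈r v∈t → ∈-tabulate-does⁺ (alive? s)
        ( ℕ.≤-trans (proj₁ (∈-tabulate-does⁻ (alive? r) v∈r)) r≤s
        , ℕ.≤-trans s≤t (proj₂ (∈-tabulate-does⁻ (alive? t) v∈t)) )
    }
    where
    covers-edge : ∀ {u v} → u ~ v → ∃[ t ] (u ∈ Vec.tabulate (does ∘ alive? t) ×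
                                            v ∈ Vec.tabulate (does ∘ alive? t))
    -- Both endpoints are alive when the later one is born.
    covers-edge {u} {v} u~v with ℕ.≤-total (toℕ (lo u)) (toℕ (lo v))
    ... | inj₁ u≤v = lo v , ∈-tabulate-does⁺ (alive? (lo v)) (u≤v , lo≤hi-adj (symm u~v))
                          , ∈-tabulate-does⁺ (alive? (lo v)) (ℕ.≤-refl , lo≤hi v)
    ... | inj₂ v≤u = lo u , ∈-tabulate-does⁺ (alive? (lo u)) (ℕ.≤-refl , lo≤hi u)
                          , ∈-tabulate-does⁺ (alive? (lo u)) (v≤u , lo≤hi-adj u~v)

  -- If intersecting intervals of distinct vertices have different colours,
  -- every bag has at most as many elements as there are colours.
  colouring⇒width≤ : ∀ {w} (colour : Fin N → Fin (suc w)) →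
                     (∀ {u v} → colour u ≡ colour v →
                      toℕ (lo u) ≤ hi v → toℕ (lo v) ≤ hi u → u ≡ v) →
                     PathDecomposition.width intervalDecomposition ≤ w
  colouring⇒width≤ colour inj = width≤ intervalDecomposition λ t →
    injection⇒∣p∣≤ _ (λ {v} _ → colour v) λ u∈t v∈t same →
      let (lu≤t , t≤hu) = ∈-tabulate-does⁻ (alive? t) u∈t
          (lv≤t , t≤hv) = ∈-tabulate-does⁻ (alive? t) v∈t
      in inj same (ℕ.≤-trans lu≤t t≤hv) (ℕ.≤-trans lv≤t t≤hu)

-- Scopes of nonzero weight

module _ {N : ℕ} where
  open Constraint

  listWeight≢0⁺ : {cs : List (Constraint N)} {T : Subset N} →
                  All (λ c → value c ≢ 0ℤ) cs →
                  Any (λ c → scope c ≡ T) cs → listWeight cs T ≢ 0ℤ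
  listWeight≢0⁺ {c ∷ _} {T} (v≢0 ∷ vs≢0) any with Vec.≡-dec Bool._≟_ (scope c) T | any
  ... | yes _   | _           = v≢0
  ... | no  T≢  | here T≡     = contradiction T≡ T≢
  ... | no  _   | there any′  = listWeight≢0⁺ vs≢0 any′

  listWeight≢0⁻ : {cs : List (Constraint N)} {T : Subset N} →
                  listWeight cs T ≢ 0ℤ → Any (λ c → scope c ≡ T) cs
  listWeight≢0⁻ {[]}         w≢0 = contradiction refl w≢0
  listWeight≢0⁻ {c ∷ _} {T} w≢0 with Vec.≡-dec Bool._≟_ (scope c) T
  ... | yes T≡ = here T≡
  ... | no  _  = there (listWeight≢0⁻ w≢0)

0<m⇒+m≢0 : ∀ {m} → 0 < m → + m ≢ 0ℤ
0<m⇒+m≢0 (s≤s _) ()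

0<m⇒-m≢0 : ∀ {m} → 0 < m → ℤ.- (+ m) ≢ 0ℤ
0<m⇒-m≢0 (s≤s _) ()

0<m+1+n : ∀ m n → 0 < m + suc n
0<m+1+n m n = ℕ.<-≤-trans z<s (ℕ.m≤n+m (suc n) m)

0<S : ∀ n → 0 < S n
0<S n = 0<m+1+n (2 * n) 0

0<m*n : ∀ {m n} → 0 < m → 0 < n → 0 < m * n
0<m*n {suc m} {suc n} _ _ = z<s

0<[m+1+a]*S : ∀ m a n → 0 < (m + suc a) * S n
0<[m+1+a]*S m a n = 0<m*n (0<m+1+n m a) (0<S n)

-- M 1 is 0; linking constraints only use M at indices from 2.
0<M : ∀ k → 0 < M (2 + k)
0<M k = 0<m*n {6} z<s
  (ℕ.m<n⇒0<n∸m (ℕ.^-monoʳ-< 2 (s≤s (s≤s z≤n)) {1} {2 + k} (s≤s z<s)))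

-- The edges of the constraint graph

-- The successor on the cycle of a gadget, the variables (k,1), ..., (k,6) being
-- numbered from 0.
next : Fin 6 → Fin 6
next 0F = 1F
next 1F = 2F
next 2F = 5F
next 5F = 4F
next 4F = 3F
next 3F = 0F

-- The predecessor on the cycle.
prev : Fin 6 → Fin 6
prev 1F = 0F
prev 2F = 1F
prev 5F = 2F
prev 4F = 5F
prev 3F = 4F
prev 0F = 3F

prev∘next : ∀ i → prev (next i) ≡ i
prev∘next = from-yes (Fin.all? λ i → prev (next i) Fin.≟ i)

next∘prev : ∀ i → next (prev i) ≡ i
next∘prev = from-yes (Fin.all? λ i → next (prev i) Fin.≟ i)

next≢prev : ∀ i → next i ≢ prev i
next≢prev = from-yes (Fin.all? λ i → ¬? (next i Fin.≟ prev i))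

next≢id : ∀ i → next i ≢ i
next≢id = from-yes (Fin.all? λ i → ¬? (next i Fin.≟ i))

-- The variables as pairs of a gadget and a position in it, both numbered from 0.
Var : ℕ → Set
Var m = Fin m × Fin 6

infix 4 _⟶_ _─_

-- The edges, each in one orientation. The link is stated by an equation of
-- natural numbers, to avoid suc and inject₁ in the indices.
data _⟶_ {m : ℕ} : Var m → Var m → Set where
  cycle : ∀ {k i j} → next i ≡ j           → (k , i) ⟶ (k , j)
  link  : ∀ {k k′}  → toℕ k′ ≡ suc (toℕ k) → (k′ , 5F) ⟶ (k , 0F)

-- Adjacency of variables, as a relation on pairs.
_─_ : ∀ {m} → Var m → Var m → Set
_─_ = SymClosure _⟶_

-- Conversion between the vertices of the constraint graph and pairs.
var : ∀ {m} → Fin (m * 6) → Var m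
var {m} = remQuot {m} 6

index : ∀ {m} → Var m → Fin (m * 6)
index = uncurry combine

index∘var : ∀ {m} (u : Fin (m * 6)) → index (var {m} u) ≡ u
index∘var {m} = Fin.combine-remQuot {m} 6

var∘index : ∀ {m} (a : Var m) → var (index a) ≡ a
var∘index (k , i) = Fin.remQuot-combine k i

index-injective : ∀ {m} {a b : Var m} → index a ≡ index b → a ≡ b
index-injective {a = a} {b} eq =
  trans (sym (var∘index a)) (trans (cong var eq) (var∘index b))

var-injective : ∀ {m} {u v : Fin (m * 6)} → var {m} u ≡ var v → u ≡ v
var-injective {m} {u} {v} eq = trans (sym (index∘var {m} u)) (trans (cong index eq) (index∘var {m} v))

⟶-irrefl : ∀ {m} {a b : Var m} → a ⟶ b → a ≢ b
⟶-irrefl (cycle {i = i} next≡) refl = next≢id i next≡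

-- The scope with the elements a and b.
pair : ∀ {m} → Var m → Var m → Subset (m * 6)
pair a b = ⁅ index a ⁆ ∪ ⁅ index b ⁆

module _ {m : ℕ} where
  open Constraint

  -- What holds of every listed constraint: its value is nonzero, and its scope
  -- is a singleton or an edge.
  record Admissible (c : Constraint (m * 6)) : Set where
    constructor admissible
    field
      value≢0 : value c ≢ 0ℤ
      shape   : (∃[ u ] scope c ≡ ⁅ u ⁆) ⊎
                (Σ[ a ∈ Var m ] Σ[ b ∈ Var m ] (a ─ b × scope c ≡ pair a b))

  unary-admissible : ∀ {u w} → w ≢ 0ℤ → Admissible (unary u w)
  unary-admissible w≢0 = admissible w≢0 (inj₁ (_ , refl))

  binary-admissible : ∀ {a b w} → a ─ b → w ≢ 0ℤ → Admissible (binary (index a) (index b) w)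
  binary-admissible a─b w≢0 = admissible w≢0 (inj₂ (_ , _ , a─b , refl))

  gadget-admissible : ∀ σ n l (k : Fin m) → All Admissible (gadget σ n l (combine k))
  gadget-admissible σ n l k =
      unary-admissible (c₁≢0 σ)
    ∷ unary-admissible (0<m⇒-m≢0 (ℕ.<-≤-trans (0<[m+1+a]*S (M l) 3 n) (ℕ.m≤m+n _ (s n l))))
    ∷ unary-admissible (0<m⇒-m≢0 (0<[m+1+a]*S (M l) 2 n))
    ∷ unary-admissible (0<m⇒-m≢0 (0<[m+1+a]*S (M l) 4 n))
    ∷ unary-admissible (0<m⇒-m≢0 (0<S n))
    ∷ unary-admissible (0<m⇒-m≢0 (0<[m+1+a]*S (M l) 0 n))
    ∷ binary-admissible (fwd (cycle refl)) (0<m⇒+m≢0 (0<[m+1+a]*S (M l) 4 n))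
    ∷ binary-admissible (bwd (cycle refl))
        (0<m⇒+m≢0 (ℕ.<-≤-trans (0<[m+1+a]*S (M l) 4 n) (ℕ.m≤m+n _ (s n l))))
    ∷ binary-admissible (fwd (cycle refl)) (0<m⇒+m≢0 (0<[m+1+a]*S (M l) 3 n))
    ∷ binary-admissible (bwd (cycle refl)) (0<m⇒+m≢0 (0<[m+1+a]*S (M l) 3 n))
    ∷ binary-admissible (fwd (cycle refl)) (0<m⇒+m≢0 (0<[m+1+a]*S (M l) 1 n))
    ∷ binary-admissible (bwd (cycle refl)) (0<m⇒-m≢0 (0<[m+1+a]*S (M l) 1 n))
    ∷ []
    where
    -- The weight of (k,1) is the only one that depends on the sign.
    c₁≢0 : ∀ σ → value (lookup (gadget σ n l (combine k)) 0F) ≢ 0ℤ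
    c₁≢0 Sign.- = 0<m⇒-m≢0 (0<[m+1+a]*S (2 * (M l + 5)) 0 n)
    c₁≢0 Sign.+ = 0<m⇒+m≢0 (0<S n)

  -- Every edge of the cycle of gadget k is the scope of a constraint.
  gadget-cycle : ∀ σ n l (k : Fin m) i →
                 Any (λ c → scope c ≡ pair (k , i) (k , next i)) (gadget σ n l (combine k))
  gadget-cycle σ n l k = λ where
      0F → skip (here refl)
      1F → skip (there (there (here refl)))
      2F → skip (there (there (there (there (here refl)))))
      3F → skip (there (here (flip 0F 3F)))
      4F → skip (there (there (there (here (flip 3F 4F)))))
      5F → skip (there (there (there (there (there (here (flip 4F 5F)))))))
    where
    flip : ∀ i j → pair (k , i) (k , j) ≡ pair (k , j) (k , i)
    flip i j = ∪-comm ⁅ combine k i ⁆ ⁅ combine k j ⁆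
    -- The six unary constraints come first.
    skip : ∀ {A : Set} {P : A → Set} {a b c d e f : A} {xs} → Any P xs →
           Any P (a ∷ b ∷ c ∷ d ∷ e ∷ f ∷ xs)
    skip = there ∘ there ∘ there ∘ there ∘ there ∘ there

constraints≤-admissible : ∀ σ n m → All (Admissible {m}) (constraints≤ σ n m)
constraints≤-admissible σ n zero    = []
constraints≤-admissible σ n (suc m) =
  All.++⁺ (gadget-admissible σ n (suc m) (fromℕ m))
  (All.++⁺
    (All.concat⁺ (All.map⁺ (All.tabulate⁺ λ k →
      gadget-admissible Sign.- n (suc (toℕ k)) (inject₁ k))))
    (All.map⁺ (All.tabulate⁺ λ k → binary-admissible
      (fwd (link (cong suc (sym (Fin.toℕ-inject₁ k)))))
      (0<m⇒+m≢0 (0<m*n (0<M (toℕ k)) (0<S n))))))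

-- Every edge is the scope of a listed constraint.
⟶⇒scope : ∀ σ n m {a b : Var m} → a ⟶ b →
            Any (λ c → Constraint.scope c ≡ pair a b) (constraints≤ σ n m)
⟶⇒scope σ n (suc m) (cycle {k} {i} refl) with view k
... | ‵fromℕ        = Any.++⁺ˡ (gadget-cycle σ n (suc m) (fromℕ m) i)
... | ‵inj₁ {i = j} _ = Any.++⁺ʳ (gadget σ n (suc m) (combine (fromℕ m))) (Any.++⁺ˡ
  (Any.concat⁺ (Any.map⁺ (Any.tabulate⁺ j
    (gadget-cycle Sign.- n (suc (toℕ j)) (inject₁ j) i)))))
⟶⇒scope σ n (suc m) (link {k} {suc j} k′≡1+k)
  with refl ← Fin.toℕ-injective {i = k} {inject₁ j}
                (trans (sym (ℕ.suc-injective k′≡1+k)) (sym (Fin.toℕ-inject₁ j))) =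
  Any.++⁺ʳ (gadget σ n (suc m) (combine (fromℕ m))) (Any.++⁺ʳ _
    (Any.map⁺ (Any.tabulate⁺ j refl)))

module _ (σ : Sign) (n m : ℕ) where
  open Graph (constraintGraph (C≤ σ n m))

  ⟶⇒~ : {a b : Var m} → a ⟶ b → index a ~ index b
  ⟶⇒~ a⟶b = ⟶-irrefl a⟶b ∘ index-injective {m} ,
    listWeight≢0⁺ (All.map Admissible.value≢0 (constraints≤-admissible σ n m)) (⟶⇒scope σ n m a⟶b)

  ─⇒~ : {a b : Var m} → a ─ b → index a ~ index b
  ─⇒~ (fwd a⟶b) = ⟶⇒~ a⟶b
  ─⇒~ (bwd b⟶a) = symm (⟶⇒~ b⟶a)

  ~⇒─ : ∀ {u v} → u ~ v → var u ─ var v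
  ~⇒─ {u} {v} (u≢v , w≢0)
    with All.lookupAny (All.map Admissible.shape (constraints≤-admissible σ n m)) (listWeight≢0⁻ w≢0)
  ... | inj₁ (a , ≡⁅a⁆) , ≡⁅uv⁆ = contradiction (trans (sym ≡⁅a⁆) ≡⁅uv⁆) (⁅⁆≢⁅⁆∪⁅⁆ u≢v)
  ... | inj₂ (a , b , a─b , ≡⁅ab⁆) , ≡⁅uv⁆
    with ⁅⁆∪⁅⁆-injective u≢v (trans (sym ≡⁅ab⁆) ≡⁅uv⁆)
  ... | inj₁ (refl , refl) = subst₂ _─_ (sym (var∘index a)) (sym (var∘index b)) a─b
  ... | inj₂ (refl , refl) = subst₂ _─_ (sym (var∘index b)) (sym (var∘index a))
                               (SymClosure.symmetric _⟶_ a─b)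

-- Degrees

-- The kind of an edge as seen from its endpoint a: to the successor, to the
-- predecessor, or a link. Both orientations of a link may share a label, since
-- links leave only from position 5 and arrive only at position 0.
direction : ∀ {m} {a b : Var m} → a ─ b → Fin 3
direction (fwd (cycle _)) = 0F
direction (bwd (cycle _)) = 1F
direction (fwd (link _))  = 2F
direction (bwd (link _))  = 2F

direction-injective : ∀ {m} {a b c : Var m} (a─b : a ─ b) (a─c : a ─ c) →
                      direction a─b ≡ direction a─c → b ≡ c
direction-injective (fwd (cycle refl)) (fwd (cycle refl)) _ = refl
direction-injective (fwd (cycle _)) (bwd (cycle _)) ()
direction-injective (fwd (cycle _)) (bwd (link _)) ()
direction-injective (bwd (cycle _)) (fwd (cycle _)) ()
direction-injective (bwd (cycle _)) (fwd (link _)) ()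
direction-injective (bwd (link _)) (fwd (cycle _)) ()
direction-injective (fwd (link _)) (bwd (cycle _)) ()
direction-injective (bwd (cycle {i = i} p)) (bwd (cycle {i = j} q)) _ =
  cong (_ ,_) (trans (sym (prev∘next i)) (trans (cong prev (trans p (sym q))) (prev∘next j)))
direction-injective (fwd (link p)) (fwd (link q)) _ =
  cong (_, 0F) (Fin.toℕ-injective (ℕ.suc-injective (trans (sym p) q)))
direction-injective (bwd (link p)) (bwd (link q)) _ =
  cong (_, 5F) (Fin.toℕ-injective (trans p (sym q)))

module _ (σ : Sign) (n m : ℕ) where
  private
    G = constraintGraph (C≤ σ n m)
  open Graph G

  degree≤3 : ∀ u → degree u ≤ 3
  degree≤3 u = injection⇒∣p∣≤ (neighbours u) (direction ∘ u─) λ v∈ w∈ eq →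
    var-injective {m} (direction-injective (u─ v∈) (u─ w∈) eq)
    where
    u─ : ∀ {v} → v ∈ neighbours u → var u ─ var v
    u─ v∈ = ~⇒─ σ n m (∈-tabulate-does⁻ (u ~?_) v∈)

  3≤degree : {k k′ : Fin m} → toℕ k′ ≡ suc (toℕ k) → 3 ≤ degree (index (k , 0F))
  3≤degree {k} {k′} k′≡1+k =
    3≤∣p∣ (neighbour (fwd (cycle refl))) (neighbour (bwd (cycle refl)))
      (neighbour (bwd (link k′≡1+k)))
      (≢ λ ()) (≢ λ ()) (≢ λ ())
    where
    neighbour : ∀ {b} → (k , 0F) ─ b → index b ∈ neighbours (index (k , 0F))
    neighbour a─b = ∈-tabulate-does⁺ (index (k , 0F) ~?_) (─⇒~ σ n m a─b)
    ≢ : {a b : Var m} → proj₂ a ≢ proj₂ b → index a ≢ index b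
    ≢ i≢j = i≢j ∘ cong proj₂ ∘ index-injective {m}

maxDegree≤3 : ∀ σ n m → maxDegree (constraintGraph (C≤ σ n m)) ≤ 3
maxDegree≤3 σ n m = maxDegree≤ (constraintGraph (C≤ σ n m)) (degree≤3 σ n m)

maxDegree≡3 : ∀ σ n m → 2 ≤ m → maxDegree (constraintGraph (C≤ σ n m)) ≡ 3
maxDegree≡3 σ n m@(suc (suc _)) (s≤s (s≤s _)) = ℕ.≤-antisym (maxDegree≤3 σ n m)
  (ℕ.≤-trans (3≤degree σ n m {0F} {1F} refl)
    (degree≤maxDegree (constraintGraph (C≤ σ n m)) (index {m} (0F , 0F))))

-- A path decomposition of width two

-- Gadget k, numbered from 0, is swept in the slots 5 k, ..., 5 k + 4, along the
-- two arcs 5, 2, 1, 0 and 5, 4, 3, 0 of its cycle. Position i is alive in the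
-- slots 5 k + birth i, ..., 5 k + death i. Position 0 stays alive in the first
-- slot of gadget k + 1, where it meets position 5 of that gadget. The bags of
-- gadget k thus hold the positions 5; 5, 2, 4; 2, 4, 1; 4, 1, 3; 1, 3, 0; the first
-- bag also holds position 0 of gadget k - 1 if there is one.
birth : Fin 6 → Fin 5
birth 5F = 0F
birth 2F = 1F
birth 4F = 1F
birth 1F = 2F
birth 3F = 3F
birth 0F = 4F

death : Fin 6 → ℕ
death 5F = 1
death 2F = 2
death 4F = 3
death 1F = 4
death 3F = 4
death 0F = 5

-- Positions of the same colour have disjoint intervals, within a gadget and
-- between different gadgets.
colour : Fin 6 → Fin 3
colour 5F = 0F
colour 1F = 0F
colour 2F = 1F
colour 3F = 1F
colour 4F = 2F
colour 0F = 2F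

birth≤death : ∀ i → toℕ (birth i) ≤ death i
birth≤death = from-yes (Fin.all? λ i → toℕ (birth i) ℕ.≤? death i)

birth≤death-next : ∀ i → toℕ (birth i) ≤ death (next i)
birth≤death-next = from-yes (Fin.all? λ i → toℕ (birth i) ℕ.≤? death (next i))

birth-next≤death : ∀ i → toℕ (birth (next i)) ≤ death i
birth-next≤death = from-yes (Fin.all? λ i → toℕ (birth (next i)) ℕ.≤? death i)

colour-separates : ∀ i j → colour i ≡ colour j →
                   toℕ (birth i) ≤ death j → toℕ (birth j) ≤ death i → i ≡ j
colour-separates = from-yes (Fin.all? λ i → Fin.all? λ j → colour i Fin.≟ colour j →-dec
  (toℕ (birth i) ℕ.≤? death j →-dec (toℕ (birth j) ℕ.≤? death i →-dec i Fin.≟ j)))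

-- A position of a gadget dies before one of the same colour in the next gadget is born.
colour-separates-gadgets : ∀ i j → colour i ≡ colour j → death i < 5 + toℕ (birth j)
colour-separates-gadgets = from-yes (Fin.all? λ i → Fin.all? λ j → colour i Fin.≟ colour j →-dec
  suc (death i) ℕ.≤? 5 + toℕ (birth j))

-- The first slot in which a variable is alive.
start : ∀ {m} → Var m → Fin (m * 5)
start (k , i) = combine k (birth i)

-- The last slot in which a variable is alive; for position 0 of the last gadget
-- this is 5 m, one more than the last slot.
end : ∀ {m} → Var m → ℕ
end (k , i) = 5 * toℕ k + death i

module _ {m : ℕ} where

  toℕ-start : ∀ (k : Fin m) i → toℕ (start (k , i)) ≡ 5 * toℕ k + toℕ (birth i)
  toℕ-start k i = Fin.toℕ-combine k (birth i)

  start≤end⁺ : ∀ (k : Fin m) {i j} → toℕ (birth i) ≤ death j → toℕ (start (k , i)) ≤ end (k , j)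
  start≤end⁺ k {i} b≤d rewrite toℕ-start k i = ℕ.+-monoʳ-≤ (5 * toℕ k) b≤d

  start≤end⁻ : ∀ (k : Fin m) {i j} → toℕ (start (k , i)) ≤ end (k , j) → toℕ (birth i) ≤ death j
  start≤end⁻ k {i} s≤e rewrite toℕ-start k i = ℕ.+-cancelˡ-≤ (5 * toℕ k) _ _ s≤e

  5*k+5≡5*[1+k] : (k : Fin m) → 5 * toℕ k + 5 ≡ 5 * suc (toℕ k)
  5*k+5≡5*[1+k] k = trans (ℕ.+-comm _ 5) (sym (ℕ.*-suc 5 (toℕ k)))

  -- The intervals of adjacent variables meet.
  ─⇒start≤end : {a b : Var m} → a ─ b → toℕ (start a) ≤ end b
  ─⇒start≤end (fwd (cycle {k} {i} refl)) = start≤end⁺ k (birth≤death-next i)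
  ─⇒start≤end (bwd (cycle {k} {i} refl)) = start≤end⁺ k (birth-next≤death i)
  ─⇒start≤end (fwd (link {k} {k′} k′≡1+k)) rewrite toℕ-start k′ 5F | k′≡1+k =
    ℕ.≤-reflexive (trans (ℕ.+-identityʳ _) (sym (5*k+5≡5*[1+k] k)))
  ─⇒start≤end (bwd (link {k} {k′} k′≡1+k)) rewrite toℕ-start k 0F | k′≡1+k =
    ℕ.≤-trans (ℕ.+-monoʳ-≤ (5 * toℕ k) (ℕ.n≤1+n 4))
      (ℕ.≤-trans (ℕ.≤-reflexive (5*k+5≡5*[1+k] k)) (ℕ.m≤m+n _ 1))

  end<start : ∀ {k l : Fin m} i j → k Fin.< l → colour i ≡ colour j →
              end (k , i) < toℕ (start (l , j))
  end<start {k} {l} i j k<l same rewrite toℕ-start l j = begin-strict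
    5 * toℕ k + death i               <⟨ ℕ.+-monoʳ-< (5 * toℕ k) (colour-separates-gadgets i j same) ⟩
    5 * toℕ k + (5 + toℕ (birth j))   ≡⟨ ℕ.+-assoc (5 * toℕ k) 5 _ ⟨
    5 * toℕ k + 5 + toℕ (birth j)     ≡⟨ cong (_+ toℕ (birth j)) (5*k+5≡5*[1+k] k) ⟩
    5 * suc (toℕ k) + toℕ (birth j)   ≤⟨ ℕ.+-monoˡ-≤ _ (ℕ.*-monoʳ-≤ 5 k<l) ⟩
    5 * toℕ l + toℕ (birth j)         ∎
    where open ℕ.≤-Reasoning

  sameColour⇒disjoint : (a b : Var m) → colour (proj₂ a) ≡ colour (proj₂ b) →
                        toℕ (start a) ≤ end b → toℕ (start b) ≤ end a → a ≡ b
  sameColour⇒disjoint (k , i) (l , j) same a≤b b≤a with Fin.<-cmp k l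
  ... | tri< k<l _ _  = contradiction b≤a (ℕ.<⇒≱ (end<start i j k<l same))
  ... | tri> _ _ l<k  = contradiction a≤b (ℕ.<⇒≱ (end<start j i l<k (sym same)))
  ... | tri≈ _ refl _ = cong (k ,_)
    (colour-separates i j same (start≤end⁻ k a≤b) (start≤end⁻ k b≤a))

module _ (σ : Sign) (n m : ℕ) where
  private
    G = constraintGraph (C≤ σ n m)

    lo : Fin (m * 6) → Fin (m * 5)
    lo = start ∘ var {m}

    hi : Fin (m * 6) → ℕ
    hi = end ∘ var {m}

    lo≤hi : ∀ u → toℕ (lo u) ≤ hi u
    lo≤hi u = start≤end⁺ (proj₁ (var {m} u)) (birth≤death (proj₂ (var {m} u)))

  slotDecomposition : PathDecomposition G
  slotDecomposition = intervalDecomposition G lo hi lo≤hi (─⇒start≤end {m} ∘ ~⇒─ σ n m)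

  slotDecomposition-width≤2 : PathDecomposition.width slotDecomposition ≤ 2
  slotDecomposition-width≤2 = colouring⇒width≤ G lo hi lo≤hi (─⇒start≤end {m} ∘ ~⇒─ σ n m)
    (colour ∘ proj₂ ∘ var {m})
    λ {u} {v} same lu≤hv lv≤hu →
      var-injective {m} (sameColour⇒disjoint (var u) (var v) same lu≤hv lv≤hu)

-- The cycle of any gadget k forces this.
2≤pathwidth : ∀ σ n {m} → Fin m → (D : PathDecomposition (constraintGraph (C≤ σ n m))) →
              2 ≤ PathDecomposition.width D
2≤pathwidth σ n {m} k D = minDegree2⇒2≤width D (λ i → index (k , i)) next prev
  (λ i → ─⇒~ σ n m {k , i} {k , next i} (fwd (cycle refl)))
  (λ i → ─⇒~ σ n m {k , i} {k , prev i} (bwd (cycle (next∘prev i))))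
  (λ i → next≢prev i ∘ cong proj₂ ∘ index-injective {m})

pathwidth≡2 : ∀ σ n {m} → Fin m → HasPathwidth (constraintGraph (C≤ σ n m)) 2
pathwidth≡2 σ n {m} k = hasPathwidth (slotDecomposition σ n m)
  (slotDecomposition-width≤2 σ n m) (2≤pathwidth σ n k)

proposition3 : (n m : ℕ) → 1 ≤ m → m ≤ n → (σ : Sign) →
    maxDegree (constraintGraph (C≤ σ n m)) ≤ 3 ×
    (2 ≤ m → maxDegree (constraintGraph (C≤ σ n m)) ≡ 3) ×
    HasPathwidth (constraintGraph (C≤ σ n m)) 2
proposition3 n m@(suc _) _ _ σ = maxDegree≤3 σ n m , maxDegree≡3 σ n m , pathwidth≡2 σ n {m} 0F
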